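{- Let $G$ be a connected graph, let $e=uv$ be a cut edge of $G$ with $\deg(u),\deg(v)\geq 2$, and let $G'=G\setminus\{e\}$. Then $$meg(G)\leq meg(G')\leq meg(G)+2.$$ Moreover, both the lower and the upper bounds are tight (i.e. each is attained with equality by some such $G$ and $e$).
   Context: Graphs are finite, undirected and simple. A cut edge is an edge whose removal increases the number of connected components. In a connected graph $H$, an edge $e$ is monitored by a pair of vertices $x,y$ if $e$ lies on all shortest paths between $x$ and $y$. A set $M\subseteq V(H)$ is a monitoring edge-geodetic set (MEG-set) of $H$ if every edge of $H$ is monitored by some pair of vertices of $M$; $meg(H)$ is the minimum size of a MEG-set of $H$. For a disconnected graph, a MEG-set is the union of MEG-sets of its connected components, where the MEG-set of an isolated vertex is taken to be empty; so $meg$ is the sum of the $meg$ of the components, an isolated vertex contributing $0$. -}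

module Defs where

open import Data.Bool.Properties using () renaming (_≟_ to _≟ᵇ_)
open import Data.Empty using (⊥-elim)
open import Data.Fin using (Fin; zero; suc)
open import Data.Fin.Properties using (_≟_; all?; any?; injective⇒≤)
open import Data.Fin.Subset using (Subset; inside; outside; _∈_; _⊆_; _∩_; ∣_∣; ⊥; Nonempty)
open import Data.Fin.Subset.Properties using (_∈?_; _⊆?_; x∈p∩q⁺)
open import Data.List using (List; []; _∷_; _++_; length; map; filter; deduplicate; allFin; lookup)
open import Data.List.Extrema.Nat using (min)
open import Data.List.Membership.Propositional.Properties using (∈-lookup)
open import Data.List.Relation.Binary.Infix.Heterogeneous using (Infix)
open import Data.List.Relation.Binary.Infix.Heterogeneous.Properties using (infix?)
open import Data.List.Relation.Unary.All as All using (All)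
open import Data.List.Relation.Unary.AllPairs using (_∷_)
open import Data.List.Relation.Unary.Unique.Propositional using (Unique)
open import Data.List.Relation.Unary.Unique.DecPropositional using (unique?)
open import Data.Nat as ℕ using (ℕ; zero; suc; _≤_; _<_; z≤n; s≤s)
import Data.Nat.Properties as ℕ
open import Data.Product using (∃; ∃₂; _×_; _,_; proj₁; proj₂)
open import Data.Sum using (_⊎_; inj₁; inj₂)
open import Data.Vec using (tabulate; _∷_; [])
open import Data.Vec.Properties using (≡-dec)
open import Level using (0ℓ)
open import Relation.Binary using (Rel; Decidable; Symmetric)
open import Relation.Binary.PropositionalEquality using (_≡_; refl; sym; cong)
open import Relation.Nullary using (¬_; Dec; yes; no; does; ¬?)
open import Relation.Nullary.Decidable using (map′; _×-dec_; _⊎-dec_; _→-dec_; decidable-stable)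
import Relation.Unary as U

private
  variable
    n : ℕ

-- The vertex set is allowed to be a proper subset of Fin n, so that subgraphs
-- (in particular connected components) live over the same ambient type.
record Graph (n : ℕ) : Set₁ where
  field
    V     : Subset n
    Adj   : Rel (Fin n) 0ℓ
    adj?  : Decidable Adj
    symm  : Symmetric Adj
    irref : ∀ {x} → ¬ Adj x x
    adj⇒V : ∀ {x y} → Adj x y → x ∈ V

open Graph public

comprehension : {P : U.Pred (Fin n) 0ℓ} → U.Decidable P → Subset n
comprehension P? = tabulate (λ x → does (P? x))

deg : Graph n → Fin n → ℕ
deg G x = ∣ comprehension (adj? G x) ∣

induced : Graph n → Subset n → Graph n
induced G C = record
  { V     = V G ∩ C
  ; Adj   = λ x y → Adj G x y × x ∈ C × y ∈ C
  ; adj?  = λ x y → adj? G x y ×-dec (x ∈? C) ×-dec (y ∈? C)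
  ; symm  = λ (a , p , q) → symm G a , q , p
  ; irref = λ (a , _) → irref G a
  ; adj⇒V = λ (a , p , _) → x∈p∩q⁺ (adj⇒V G a , p)
  }

SameEdge : (u v x y : Fin n) → Set
SameEdge u v x y = (x ≡ u × y ≡ v) ⊎ (x ≡ v × y ≡ u)

deleteEdge : Graph n → Fin n → Fin n → Graph n
deleteEdge G u v = record
  { V     = V G
  ; Adj   = λ x y → Adj G x y × ¬ SameEdge u v x y
  ; adj?  = λ x y → adj? G x y ×-dec
              ¬? ((x ≟ u ×-dec y ≟ v) ⊎-dec (x ≟ v ×-dec y ≟ u))
  ; symm  = λ (a , k) → symm G a , λ where
              (inj₁ (p , q)) → k (inj₂ (q , p))
              (inj₂ (p , q)) → k (inj₁ (q , p))
  ; irref = λ (a , _) → irref G a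
  ; adj⇒V = λ (a , _) → adj⇒V G a
  }

-- Walk G x y p: the list p is the vertex sequence of a walk from x to y.
data Walk (G : Graph n) : Fin n → Fin n → List (Fin n) → Set where
  stop : ∀ {x} → x ∈ V G → Walk G x x (x ∷ [])
  step : ∀ {x y z p} → Adj G x y → Walk G y z p → Walk G x z (x ∷ p)

Path : Graph n → Fin n → Fin n → List (Fin n) → Set
Path G x y p = Walk G x y p × Unique p

-- Here length counts vertices, i.e. one more than the number of edges.
ShortestPath : Graph n → Fin n → Fin n → List (Fin n) → Set
ShortestPath G x y p = Path G x y p × (∀ q → Path G x y q → length p ≤ length q)

LiesOn : (a b : Fin n) → List (Fin n) → Set
LiesOn a b p = Infix _≡_ (a ∷ b ∷ []) p ⊎ Infix _≡_ (b ∷ a ∷ []) p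

-- Only to be used when x and y lie in the same component: otherwise there is
-- no path between them and the condition is vacuous.
Monitors : Graph n → (x y a b : Fin n) → Set
Monitors G x y a b = ∀ p → ShortestPath G x y p → LiesOn a b p

Reachable : Graph n → Rel (Fin n) 0ℓ
Reachable G x y = ∃ (Path G x y)

Connected : Graph n → Set
Connected G = Nonempty (V G) × (∀ x y → x ∈ V G → y ∈ V G → Reachable G x y)

walk? : (G : Graph n) (x y : Fin n) → U.Decidable (Walk G x y)
walk? G x y [] = no λ ()
walk? G x y (z ∷ []) =
  map′ (λ { (refl , refl , i) → stop i })
       (λ { (stop i) → refl , refl , i ; (step _ ()) })
       (x ≟ z ×-dec y ≟ z ×-dec z ∈? V G)
walk? G x y (z ∷ w ∷ p) =
  map′ (λ { (refl , a , r) → step a r })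
       (λ { (step a r@(stop _)) → refl , a , r ; (step a r@(step _ _)) → refl , a , r })
       (x ≟ z ×-dec adj? G x w ×-dec walk? G w y (w ∷ p))

path? : (G : Graph n) (x y : Fin n) → U.Decidable (Path G x y)
path? G x y p = walk? G x y p ×-dec unique? _≟_ p

lookup-injective : ∀ {A : Set} {xs : List A} → Unique xs →
                   ∀ {i j} → lookup xs i ≡ lookup xs j → i ≡ j
lookup-injective (_ ∷ _) {zero}  {zero}  _  = refl
lookup-injective {xs = _ ∷ xs} (x∉ ∷ _) {zero}  {suc j} eq = ⊥-elim (All.lookup x∉ (∈-lookup {xs = xs} j) eq)
lookup-injective {xs = _ ∷ xs} (x∉ ∷ _) {suc i} {zero}  eq = ⊥-elim (All.lookup x∉ (∈-lookup {xs = xs} i) (sym eq))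
lookup-injective (_ ∷ u) {suc i} {suc j} eq = cong suc (lookup-injective u eq)

unique⇒length≤ : {p : List (Fin n)} → Unique p → length p ≤ n
unique⇒length≤ u = injective⇒≤ (lookup-injective u)

searchList : ∀ k {P : U.Pred (List (Fin n)) 0ℓ} → U.Decidable P →
             Dec (∃ λ p → length p ≤ k × P p)
searchList zero P? =
  map′ (λ h → [] , z≤n , h) (λ { ([] , _ , h) → h }) (P? [])
searchList (suc k) P? =
  map′ (λ { (inj₁ h) → [] , z≤n , h
          ; (inj₂ (x , p , l , h)) → x ∷ p , s≤s l , h })
       (λ { ([] , _ , h) → inj₁ h
          ; (x ∷ p , s≤s l , h) → inj₂ (x , p , l , h) })
       (P? [] ⊎-dec any? λ x → searchList k (λ p → P? (x ∷ p)))

anyPath? : (G : Graph n) (x y : Fin n) {P : U.Pred (List (Fin n)) 0ℓ} → U.Decidable P →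
           Dec (∃ λ p → Path G x y p × P p)
anyPath? {n} G x y P? =
  map′ (λ (p , _ , h) → p , h)
       (λ (p , h) → p , unique⇒length≤ (proj₂ (proj₁ h)) , h)
       (searchList n (λ p → path? G x y p ×-dec P? p))

allPaths? : (G : Graph n) (x y : Fin n) {P : U.Pred (List (Fin n)) 0ℓ} → U.Decidable P →
            Dec (∀ p → Path G x y p → P p)
allPaths? G x y P? =
  map′ (λ none p h → decidable-stable (P? p) (λ ¬Pp → none (p , h , ¬Pp)))
       (λ all (p , h , ¬Pp) → ¬Pp (all p h))
       (¬? (anyPath? G x y (λ p → ¬? (P? p))))

reachable? : (G : Graph n) → Decidable (Reachable G)
reachable? G x y =
  map′ (λ (p , h , _) → p , h) (λ (p , h) → p , h , h) (anyPath? G x y (path? G x y))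

monitors? : (G : Graph n) (x y a b : Fin n) → Dec (Monitors G x y a b)
monitors? G x y a b =
  map′ (λ f p (h , s) → f p h s) (λ f p h s → f p (h , s))
    (allPaths? G x y λ p →
      allPaths? G x y (λ q → length p ℕ.≤? length q)
        →-dec (infix? _≟_ (a ∷ b ∷ []) p ⊎-dec infix? _≟_ (b ∷ a ∷ []) p))

componentOf : Graph n → Fin n → Subset n
componentOf G x = comprehension (reachable? G x)

components : Graph n → List (Subset n)
components {n} G =
  deduplicate (≡-dec _≟ᵇ_) (map (componentOf G) (filter (_∈? V G) (allFin n)))

CutEdge : Graph n → Fin n → Fin n → Set
CutEdge G u v =
  Adj G u v × length (components G) < length (components (deleteEdge G u v))

ConnectedMEGSet : Graph n → Subset n → Set
ConnectedMEGSet H M =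
  M ⊆ V H ×
  (∀ a b → Adj H a b → ∃₂ λ x y → x ∈ M × y ∈ M × Monitors H x y a b)

ComponentMEGSet : Graph n → Subset n → Set
ComponentMEGSet H M = ConnectedMEGSet H M × (∣ V H ∣ ≡ 1 → M ≡ ⊥)

-- The components partition V G, so M ⊆ V G is a union of sets M_C ⊆ C, one for
-- each component C, exactly when M_C = M ∩ C.
MEGSet : Graph n → Subset n → Set
MEGSet G M =
  M ⊆ V G × All (λ C → ComponentMEGSet (induced G C) (M ∩ C)) (components G)

connectedMEGSet? : (H : Graph n) → U.Decidable (ConnectedMEGSet H)
connectedMEGSet? H M =
  (M ⊆? V H) ×-dec
  all? λ a → all? λ b → adj? H a b →-dec
    any? λ x → any? λ y → (x ∈? M) ×-dec (y ∈? M) ×-dec monitors? H x y a b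

megSet? : (G : Graph n) → U.Decidable (MEGSet G)
megSet? G M =
  (M ⊆? V G) ×-dec
  All.all? (λ C → connectedMEGSet? (induced G C) (M ∩ C)
                   ×-dec (∣ V (induced G C) ∣ ℕ.≟ 1 →-dec ≡-dec _≟ᵇ_ (M ∩ C) ⊥))
           (components G)

subsets : ∀ n → List (Subset n)
subsets zero    = [] ∷ []
subsets (suc n) = map (inside ∷_) (subsets n) ++ map (outside ∷_) (subsets n)

-- The first argument of min does not affect the result: the set of all
-- non-isolated vertices is a MEG-set, and every subset of Fin n has size at most n.
meg : Graph n → ℕ
meg {n} G = min n (map ∣_∣ (filter (megSet? G) (subsets n)))

{-# OPTIONS --safe #-}

-- A path of G either avoids e = uv, and is a path of G' = G - e, or splits into two
-- walks of G' in different components, joined by e.  Hence pairs in one component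
-- have the same shortest paths in G and G', and a shortest path across e is a shortest
-- path to one end of e followed by one from the other end.  So a MEG-set of G' is
-- already one of G (e is monitored by any two of its vertices on opposite sides), and
-- a MEG-set of G becomes one of G' by adding u and v: a pair across e is replaced by
-- one of its vertices and the end of e on that side.
-- Pendant vertices belong to every MEG-set.  The lower bound is attained by two paths
-- on three vertices with their centres joined, the upper one by the middle edge of the
-- path on four vertices.

module Submission where

open import Defs
open import Data.Bool.Properties using () renaming (_≟_ to _≟ᵇ_)
open import Data.Empty using (⊥-elim)
open import Data.Nat using (ℕ; zero; suc; _+_; _≤_; z≤n; s≤s; _≤?_; _<?_)
import Data.Nat.Properties as ℕ
open import Data.Fin using (Fin; #_)
open import Data.Fin.Properties using (_≟_; all?; any?)
open import Data.Fin.Subset using (Subset; inside; outside; _∈_; _⊆_; _∩_; _∪_; ∣_∣; ⊥; ⊤; ⁅_⁆)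
open import Data.Fin.Subset.Properties
open import Data.List using (List; []; _∷_; _++_; length; map; filter; allFin)
open import Data.List.Extrema.Nat using (min≤⊤; min≤xs; argmin-all)
open import Data.List.Membership.Propositional using () renaming (_∈_ to _∈ˡ_)
open import Data.List.Membership.Propositional.Properties using (∈-map⁺; ∈-map⁻; ∈-filter⁺; ∈-filter⁻; ∈-allFin; ∈-++⁺ˡ; ∈-++⁺ʳ; ∈-deduplicate⁺; ∈-deduplicate⁻)
open import Data.List.Membership.DecPropositional using () renaming (_∈?_ to member?)
open import Data.List.Properties using (length-++)
open import Data.List.Relation.Binary.Infix.Heterogeneous using (Infix; here; there)
open import Data.List.Relation.Binary.Prefix.Heterogeneous using ([]; _∷_)
open import Data.List.Relation.Unary.All as All using (All; []; _∷_)
import Data.List.Relation.Unary.All.Properties as Allₚ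
open import Data.List.Relation.Unary.Any using (here; there)
open import Data.List.Relation.Unary.AllPairs using ([]; _∷_)
open import Data.List.Relation.Unary.Unique.Propositional using (Unique)
import Data.List.Relation.Unary.Unique.Propositional.Properties as Unique
import Data.List.Relation.Unary.Unique.DecPropositional.Properties as DecUnique
open import Data.Product using (_×_; _,_; ∃; ∃₂; proj₁; proj₂; ∃-syntax; Σ-syntax)
open import Data.Sum as Sum using (_⊎_; inj₁; inj₂; swap)
open import Data.Vec using ([]; _∷_)
import Data.Vec as Vec
import Data.Vec.Properties as Vec
open import Function using (id; _∘_; case_of_)
open import Level using (0ℓ)
open import Relation.Binary.PropositionalEquality using (_≡_; _≢_; refl; sym; trans; cong; cong₂; subst; subst₂)
open import Relation.Nullary using (¬_; Dec; yes; no; ¬?)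
open import Relation.Nullary.Decidable using (dec-true; does; _×-dec_; _⊎-dec_; _→-dec_; decidable-stable; from-yes)
import Relation.Unary as U

private
  variable
    n : ℕ
    G H : Graph n
    M : Subset n
    a b c s t x y z : Fin n
    p q r : List (Fin n)

-- Subsets and degrees

∈-comprehension⁺ : {P : U.Pred (Fin n) 0ℓ} (P? : U.Decidable P) → P x → x ∈ comprehension P?
∈-comprehension⁺ {x = x} P? Px =
  Vec.lookup⇒[]= x _ (trans (Vec.lookup∘tabulate _ x) (dec-true (P? x) Px))

∈-comprehension⁻ : {P : U.Pred (Fin n) 0ℓ} (P? : U.Decidable P) → x ∈ comprehension P? → P x
∈-comprehension⁻ {x = x} P? x∈
  with P? x | trans (sym (Vec.lookup∘tabulate (λ z → does (P? z)) x)) (Vec.[]=⇒lookup x∈)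
... | yes Px | _ = Px

∣p∪q∣≤∣p∣+∣q∣ : (p q : Subset n) → ∣ p ∪ q ∣ ≤ ∣ p ∣ + ∣ q ∣
∣p∪q∣≤∣p∣+∣q∣ [] [] = z≤n
∣p∪q∣≤∣p∣+∣q∣ (outside ∷ p) (outside ∷ q) = ∣p∪q∣≤∣p∣+∣q∣ p q
∣p∪q∣≤∣p∣+∣q∣ (outside ∷ p) (inside ∷ q) =
  ℕ.≤-trans (s≤s (∣p∪q∣≤∣p∣+∣q∣ p q)) (ℕ.≤-reflexive (sym (ℕ.+-suc ∣ p ∣ ∣ q ∣)))
∣p∪q∣≤∣p∣+∣q∣ (inside ∷ p) (outside ∷ q) = s≤s (∣p∪q∣≤∣p∣+∣q∣ p q)
∣p∪q∣≤∣p∣+∣q∣ (inside ∷ p) (inside ∷ q) =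
  s≤s (ℕ.≤-trans (∣p∪q∣≤∣p∣+∣q∣ p q) (ℕ.+-monoʳ-≤ ∣ p ∣ (ℕ.n≤1+n ∣ q ∣)))

∣p∣≤1 : {p : Subset n} → (∀ {y} → y ∈ p → y ≡ x) → ∣ p ∣ ≤ 1
∣p∣≤1 {x = x} {p} only = ℕ.≤-trans
  (p⊆q⇒∣p∣≤∣q∣ {p = p} {⁅ x ⁆} (λ y∈ → subst (_∈ ⁅ x ⁆) (sym (only y∈)) (x∈⁅x⁆ x)))
  (ℕ.≤-reflexive (∣⁅x⁆∣≡1 x))

∣p∣≡1 : {p : Subset n} → x ∈ p → (∀ {y} → y ∈ p → y ≡ x) → ∣ p ∣ ≡ 1
∣p∣≡1 {x = x} {p} x∈ only = ℕ.≤-antisym (∣p∣≤1 {p = p} only) (ℕ.≤-trans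
  (ℕ.≤-reflexive (sym (∣⁅x⁆∣≡1 x)))
  (p⊆q⇒∣p∣≤∣q∣ {p = ⁅ x ⁆} {p} (λ y∈ → subst (_∈ p) (sym (x∈⁅y⁆⇒x≡y x y∈)) x∈)))

∣p∣≡1⇒≡ : {p : Subset n} → ∣ p ∣ ≡ 1 → x ∈ p → y ∈ p → x ≡ y
∣p∣≡1⇒≡ {x = x} {y} {p} ∣p∣≡1 x∈ y∈ with x ≟ y
... | yes x≡y = x≡y
... | no x≢y = ⊥-elim (ℕ.<-irrefl refl (begin-strict
    1                ≡⟨ ∣⁅x⁆∣≡1 x ⟨
    ∣ ⁅ x ⁆ ∣        <⟨ p⊂q⇒∣p∣<∣q∣ {p = ⁅ x ⁆} {p} (⁅x⁆⊆p , y , y∈ , x≢y ∘ sym ∘ x∈⁅y⁆⇒x≡y x) ⟩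
    ∣ p ∣            ≡⟨ ∣p∣≡1 ⟩
    1                ∎))
  where
  open ℕ.≤-Reasoning
  ⁅x⁆⊆p : ⁅ x ⁆ ⊆ p
  ⁅x⁆⊆p z∈ = subst (_∈ p) (sym (x∈⁅y⁆⇒x≡y x z∈)) x∈

-- If every neighbour were `y`, the degree would be at most one. With `y` the other end of the cut
-- edge, this gives each end an edge that survives the deletion.
2≤deg⇒other-neighbour : (G : Graph n) → 2 ≤ deg G x → ∀ y → ∃ λ z → Adj G x z × z ≢ y
2≤deg⇒other-neighbour {x = x} G 2≤deg y with any? (λ z → adj? G x z ×-dec ¬? (z ≟ y))
... | yes h = h
... | no none = ⊥-elim (ℕ.<-irrefl refl (ℕ.≤-trans 2≤deg (∣p∣≤1 {x = y} only)))
  where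
  only : ∀ {z} → z ∈ comprehension (adj? G x) → z ≡ y
  only {z} z∈ = decidable-stable (z ≟ y)
    (λ z≢y → none (z , ∈-comprehension⁻ (adj? G x) z∈ , z≢y))

-- Walks and reachability

adj⇒Vʳ : (G : Graph n) → Adj G x y → y ∈ V G
adj⇒Vʳ G = adj⇒V G ∘ symm G

adj⇒≢ : (G : Graph n) → Adj G x y → x ≢ y
adj⇒≢ G a refl = irref G a

walk-start : Walk G x y p → x ∈ V G
walk-start (stop i) = i
walk-start {G = G} (step a _) = adj⇒V G a

walk-end : Walk G x y p → y ∈ V G
walk-end (stop i) = i
walk-end (step _ w) = walk-end w

start∈walk : Walk G x y p → x ∈ˡ p
start∈walk (stop _) = here refl
start∈walk (step _ _) = here refl

walk-map : V G ⊆ V H → (∀ {a b} → Adj G a b → Adj H a b) → Walk G x y p → Walk H x y p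
walk-map V⊆ E⊆ (stop i) = stop (V⊆ i)
walk-map V⊆ E⊆ (step a w) = step (E⊆ a) (walk-map V⊆ E⊆ w)

path-from : Path G x y p → a ∈ˡ p → ∃ λ q → Path G a y q × length q ≤ length p
path-from (stop i , u) (here refl) = _ , (stop i , u) , ℕ.≤-refl
path-from (step e w , u) (here refl) = _ , (step e w , u) , ℕ.≤-refl
path-from (step e w , _ ∷ u) (there a∈) with path-from (w , u) a∈
... | q , P , l = q , P , ℕ.m≤n⇒m≤1+n l

-- If `x` already occurs on the erased tail, the part of the tail from `x` on is kept; otherwise `x`
-- is prepended.
loop-erase : Walk G x y p → ∃ λ q → Path G x y q × length q ≤ length p
loop-erase (stop i) = _ , (stop i , [] ∷ []) , ℕ.≤-refl
loop-erase {x = x} (step a w) with loop-erase w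
... | q , (w′ , u) , l with member? _≟_ x q
...   | no x∉ = x ∷ q , (step a w′ , Allₚ.¬Any⇒All¬ q x∉ ∷ u) , s≤s l
...   | yes x∈ with path-from (w′ , u) x∈
...     | q′ , P , l′ = q′ , P , ℕ.m≤n⇒m≤1+n (ℕ.≤-trans l′ l)

walk⇒reachable : Walk G x y p → Reachable G x y
walk⇒reachable w with loop-erase w
... | q , P , _ = q , P

reachable-refl : (G : Graph n) → x ∈ V G → Reachable G x x
reachable-refl G i = walk⇒reachable (stop {G = G} i)

adj⇒reachable : (G : Graph n) → Adj G x y → Reachable G x y
adj⇒reachable G a = walk⇒reachable (step {G = G} a (stop (adj⇒Vʳ G a)))

-- Two paths glued together may repeat vertices, so loops are erased after each step.
reachable-trans : Reachable G x y → Reachable G y z → Reachable G x z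
reachable-trans (_ , w , _) = go w
  where
  go : Walk G x y p → Reachable G y z → Reachable G x z
  go (stop _) R = R
  go (step a w) R with go w R
  ... | _ , w′ , _ = walk⇒reachable (step a w′)

reachable-sym : Reachable G x y → Reachable G y x
reachable-sym {G = G} (_ , w , _) = go w
  where
  go : Walk G x y p → Reachable G y x
  go (stop i) = reachable-refl G i
  go (step a w) = reachable-trans (go w) (adj⇒reachable G (symm G a))

walk-visits : Walk G x y p → a ∈ˡ p → Reachable G x a
walk-visits {G = G} w@(stop _) (here refl) = reachable-refl G (walk-start w)
walk-visits {G = G} w@(step _ _) (here refl) = reachable-refl G (walk-start w)
walk-visits {G = G} (step e w) (there a∈) =
  reachable-trans (adj⇒reachable G e) (walk-visits w a∈)

-- Descent on the length, bounded by `k`: either no path is strictly shorter, or the search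
-- continues from a shorter one.
shortestPath : Reachable G x y → ∃ (ShortestPath G x y)
shortestPath {G = G} {x} {y} (p , P) = go (length p) p P ℕ.≤-refl
  where
  go : ∀ k p → Path G x y p → length p ≤ k → ∃ (ShortestPath G x y)
  go k p P l with anyPath? G x y (λ q → length q <? length p)
  ... | no none = p , P , λ q Q → ℕ.≮⇒≥ (λ q<p → none (q , Q , q<p))
  go zero p P l | yes (q , Q , q<p) = case ℕ.≤-trans q<p l of λ ()
  go (suc k) p P l | yes (q , Q , q<p) = go k q Q (ℕ.≤-pred (ℕ.≤-trans q<p l))

-- `ShortestPath` compares with paths only; a walk is at least as long as its loop erasure.
shortest≤walk : ShortestPath G x y p → Walk G x y q → length p ≤ length q
shortest≤walk (_ , least) w with loop-erase w
... | q , P , l = ℕ.≤-trans (least q P) l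

infix⇒∈ : Infix _≡_ (a ∷ b ∷ []) p → a ∈ˡ p × b ∈ˡ p
infix⇒∈ (here (refl ∷ refl ∷ [])) = here refl , there (here refl)
infix⇒∈ (there i) with infix⇒∈ i
... | a∈ , b∈ = there a∈ , there b∈

liesOn⇒∈ : LiesOn a b p → a ∈ˡ p
liesOn⇒∈ (inj₁ i) = proj₁ (infix⇒∈ i)
liesOn⇒∈ (inj₂ i) = proj₂ (infix⇒∈ i)

monitors⇒reachable : Reachable G x y → Monitors G x y a b → Reachable G x a
monitors⇒reachable R mon with shortestPath R
... | p , S@((w , _) , _) = walk-visits w (liesOn⇒∈ (mon p S))

monitors-swap : Monitors G x y a b → Monitors G x y b a
monitors-swap mon p S = swap (mon p S)

-- Components

∈-componentOf⁺ : (G : Graph n) → Reachable G x y → y ∈ componentOf G x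
∈-componentOf⁺ G = ∈-comprehension⁺ (reachable? G _)

∈-componentOf⁻ : (G : Graph n) → y ∈ componentOf G x → Reachable G x y
∈-componentOf⁻ G = ∈-comprehension⁻ (reachable? G _)

componentOf-cong : Reachable G x y → componentOf G x ≡ componentOf G y
componentOf-cong {G = G} R = ⊆-antisym
  (λ z∈ → ∈-componentOf⁺ G (reachable-trans (reachable-sym R) (∈-componentOf⁻ G z∈)))
  (λ z∈ → ∈-componentOf⁺ G (reachable-trans R (∈-componentOf⁻ G z∈)))

∈-components⁺ : (G : Graph n) → x ∈ V G → componentOf G x ∈ˡ components G
∈-components⁺ {x = x} G x∈ = ∈-deduplicate⁺ (Vec.≡-dec _≟ᵇ_)
  (∈-map⁺ (componentOf G) (∈-filter⁺ (_∈? V G) (∈-allFin x) x∈))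

∈-components⁻ : (G : Graph n) {C : Subset n} → C ∈ˡ components G →
                ∃ λ x → x ∈ V G × C ≡ componentOf G x
∈-components⁻ {n} G C∈
  with x , x∈ , refl ← ∈-map⁻ (componentOf G) (∈-deduplicate⁻ (Vec.≡-dec _≟ᵇ_) _ C∈)
  = x , proj₂ (∈-filter⁻ (_∈? V G) {xs = allFin n} x∈) , refl

length≤1 : {A : Set} {xs : List A} → Unique xs → (∀ {x y} → x ∈ˡ xs → y ∈ˡ xs → x ≡ y) →
           length xs ≤ 1
length≤1 {xs = []} _ _ = z≤n
length≤1 {xs = _ ∷ []} _ _ = s≤s z≤n
length≤1 {xs = _ ∷ _ ∷ _} ((x≢y ∷ _) ∷ _) eq = ⊥-elim (x≢y (eq (here refl) (there (here refl))))

1≤length : {A : Set} {x : A} {xs : List A} → x ∈ˡ xs → 1 ≤ length xs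
1≤length {xs = _ ∷ _} _ = s≤s z≤n

2≤length : {A : Set} {x y : A} {xs : List A} → x ∈ˡ xs → y ∈ˡ xs → x ≢ y → 2 ≤ length xs
2≤length (here refl) (here refl) x≢y = ⊥-elim (x≢y refl)
2≤length (here refl) (there y∈) _ = s≤s (1≤length y∈)
2≤length (there x∈) _ _ = s≤s (1≤length x∈)

components≤1 : (G : Graph n) → (∀ x y → x ∈ V G → y ∈ V G → Reachable G x y) →
               length (components G) ≤ 1
components≤1 G conn = length≤1 (DecUnique.deduplicate-! (Vec.≡-dec _≟ᵇ_) _) same
  where
  same : ∀ {C D} → C ∈ˡ components G → D ∈ˡ components G → C ≡ D
  same C∈ D∈ with ∈-components⁻ G C∈ | ∈-components⁻ G D∈
  ... | x , x∈ , refl | y , y∈ , refl = componentOf-cong (conn x y x∈ y∈)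

2≤components : (G : Graph n) → x ∈ V G → y ∈ V G → ¬ Reachable G x y → 2 ≤ length (components G)
2≤components {x = x} {y} G x∈ y∈ sep = 2≤length (∈-components⁺ G x∈) (∈-components⁺ G y∈)
  (λ eq → sep (∈-componentOf⁻ G (subst (y ∈_) (sym eq) (∈-componentOf⁺ G (reachable-refl G y∈)))))

-- MEG-sets

-- The reachability clause excludes pairs in different components, for which `Monitors` holds
-- vacuously.
Monitored : Graph n → Subset n → (a b : Fin n) → Set
Monitored G M a b = ∃₂ λ x y → x ∈ M × y ∈ M × Reachable G x y × Monitors G x y a b

-- MEGSet without reference to components: these are implicit in Reachable.
record GlobalMEGSet (G : Graph n) (M : Subset n) : Set where
  field
    ⊆V          : M ⊆ V G
    monitored   : ∀ {a b} → Adj G a b → Monitored G M a b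
    nonisolated : ∀ {x} → x ∈ M → ∃ (Adj G x)

open GlobalMEGSet

module _ {G : Graph n} {C : Subset n}
         (closed : ∀ {x y} → x ∈ C → Reachable G x y → y ∈ C) where

  -- A walk that starts in `C` never leaves it. Hence from a vertex of `C` the graph and its induced
  -- subgraph have the same shortest paths.
  walk-induced⁺ : x ∈ C → Walk G x y p → Walk (induced G C) x y p
  walk-induced⁺ x∈ (stop i) = stop (x∈p∩q⁺ (i , x∈))
  walk-induced⁺ x∈ (step a w) = step (a , x∈ , y∈) (walk-induced⁺ y∈ w)
    where y∈ = closed x∈ (adj⇒reachable G a)

  walk-induced⁻ : Walk (induced G C) x y p → Walk G x y p
  walk-induced⁻ = walk-map {G = induced G C} {H = G} (p∩q⊆p _ _) proj₁

  monitors-induced⁺ : x ∈ C → Monitors G x y a b → Monitors (induced G C) x y a b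
  monitors-induced⁺ x∈ mon p ((w , u) , least) =
    mon p ((walk-induced⁻ w , u) , λ q (w′ , u′) → least q (walk-induced⁺ x∈ w′ , u′))

  monitors-induced⁻ : x ∈ C → Monitors (induced G C) x y a b → Monitors G x y a b
  monitors-induced⁻ x∈ mon p ((w , u) , least) =
    mon p ((walk-induced⁺ x∈ w , u) , λ q (w′ , u′) → least q (walk-induced⁻ w′ , u′))

componentOf-closed : (G : Graph n) → x ∈ componentOf G z → Reachable G x y → y ∈ componentOf G z
componentOf-closed G x∈ R = ∈-componentOf⁺ G (reachable-trans (∈-componentOf⁻ G x∈) R)

MEGSet⇒GlobalMEGSet : (G : Graph n) → MEGSet G M → GlobalMEGSet G M
MEGSet⇒GlobalMEGSet {M = M} G (M⊆ , comps) = record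
  { ⊆V = M⊆ ; monitored = mon ; nonisolated = noniso }
  where
  component : x ∈ V G → let C = componentOf G x in ComponentMEGSet (induced G C) (M ∩ C)
  component x∈ = All.lookup comps (∈-components⁺ G x∈)

  mon : Adj G a b → Monitored G M a b
  mon {a} {b} e with proj₂ (proj₁ (component (adj⇒V G e))) a b
    (e , ∈-componentOf⁺ G (reachable-refl G (adj⇒V G e)) , ∈-componentOf⁺ G (adj⇒reachable G e))
  ... | x , y , x∈ , y∈ , m with x∈p∩q⁻ M _ x∈ | x∈p∩q⁻ M _ y∈
  ... | x∈M , x∈C | y∈M , y∈C = x , y , x∈M , y∈M ,
    reachable-trans (reachable-sym (∈-componentOf⁻ G x∈C)) (∈-componentOf⁻ G y∈C) ,
    monitors-induced⁻ (componentOf-closed G) x∈C m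

  noniso : x ∈ M → ∃ (Adj G x)
  noniso {x} x∈ with any? (adj? G x)
  ... | yes h = h
  -- Without neighbours `x` would be its whole component, and `ComponentMEGSet` makes `M` miss a
  -- one-vertex component.
  ... | no none = ⊥-elim (∉⊥ (subst (x ∈_) empty (x∈p∩q⁺ (x∈ , x∈C))))
    where
    x∈C = ∈-componentOf⁺ G (reachable-refl G (M⊆ x∈))
    alone : ∀ {y} → y ∈ V G ∩ componentOf G x → y ≡ x
    alone y∈ with ∈-componentOf⁻ G (p∩q⊆q (V G) _ y∈)
    ... | _ , stop _ , _ = refl
    ... | _ , step e _ , _ = ⊥-elim (none (_ , e))
    empty = proj₂ (component (M⊆ x∈)) (∣p∣≡1 (x∈p∩q⁺ (M⊆ x∈ , x∈C)) alone)

GlobalMEGSet⇒MEGSet : (G : Graph n) → GlobalMEGSet G M → MEGSet G M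
GlobalMEGSet⇒MEGSet {M = M} G g = ⊆V g , All.tabulate component
  where
  component : ∀ {C} → C ∈ˡ components G → ComponentMEGSet (induced G C) (M ∩ C)
  component C∈ with ∈-components⁻ G C∈
  ... | z , z∈ , refl = (sub , mon) , isolated
    where
    C = componentOf G z

    sub : M ∩ C ⊆ V G ∩ C
    sub x∈ with x∈p∩q⁻ M C x∈
    ... | x∈M , x∈C = x∈p∩q⁺ (⊆V g x∈M , x∈C)

    mon : ∀ a b → Adj (induced G C) a b →
          ∃₂ λ x y → x ∈ M ∩ C × y ∈ M ∩ C × Monitors (induced G C) x y a b
    mon a b (e , a∈C , _) with monitored g e
    ... | x , y , x∈M , y∈M , R , m = x , y , x∈p∩q⁺ (x∈M , x∈C) ,
        x∈p∩q⁺ (y∈M , componentOf-closed G x∈C R) , monitors-induced⁺ (componentOf-closed G) x∈C m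
      -- A shortest path between `x` and `y` runs through `a`, so the pair lies in the component of
      -- the edge.
      where x∈C = componentOf-closed G a∈C (reachable-sym (monitors⇒reachable R m))

    isolated : ∣ V G ∩ C ∣ ≡ 1 → M ∩ C ≡ ⊥
    isolated one = Empty-unique λ (x , x∈) →
      let x∈M , x∈C = x∈p∩q⁻ M C x∈
          y , e = nonisolated g x∈M
      in adj⇒≢ G e (∣p∣≡1⇒≡ one (x∈p∩q⁺ (⊆V g x∈M , x∈C))
           (x∈p∩q⁺ (adj⇒Vʳ G e , componentOf-closed G x∈C (adj⇒reachable G e))))

-- The minimum size of a MEG-set

∈-subsets : (M : Subset n) → M ∈ˡ subsets n
∈-subsets [] = here refl
∈-subsets (inside ∷ M) = ∈-++⁺ˡ (∈-map⁺ (inside ∷_) (∈-subsets M))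
∈-subsets (outside ∷ M) = ∈-++⁺ʳ _ (∈-map⁺ (outside ∷_) (∈-subsets M))

meg≤n : (G : Graph n) → meg G ≤ n
meg≤n {n} G = min≤⊤ n (map ∣_∣ (filter (megSet? G) (subsets n)))

meg≤∣M∣ : (G : Graph n) → GlobalMEGSet G M → meg G ≤ ∣ M ∣
meg≤∣M∣ {n} {M} G g = All.lookup (min≤xs n (map ∣_∣ (filter (megSet? G) (subsets n))))
  (∈-map⁺ ∣_∣ (∈-filter⁺ (megSet? G) (∈-subsets M) (GlobalMEGSet⇒MEGSet G g)))

-- The minimum is either its default value `n` or the size of a listed MEG-set.
meg-elim : (P : ℕ → Set) (G : Graph n) → P n → (∀ {M} → GlobalMEGSet G M → P ∣ M ∣) → P (meg G)
meg-elim {n} P G Pn PM = argmin-all id {P = P} Pn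
  (Allₚ.map⁺ (All.map (PM ∘ MEGSet⇒GlobalMEGSet G) (Allₚ.all-filter (megSet? G) (subsets n))))

∣L∣≤meg : (G : Graph n) (L : Subset n) → (∀ {M} → GlobalMEGSet G M → L ⊆ M) → ∣ L ∣ ≤ meg G
∣L∣≤meg G L L⊆ = meg-elim (∣ L ∣ ≤_) G (∣p∣≤n L) (λ g → p⊆q⇒∣p∣≤∣q∣ (L⊆ g))

-- Pendant vertices

Pendant : Graph n → (a b : Fin n) → Set
Pendant G a b = Adj G a b × (∀ y → Adj G a y → y ≡ b)

pendant? : (G : Graph n) (a b : Fin n) → Dec (Pendant G a b)
pendant? G a b = adj? G a b ×-dec all? λ y → adj? G a y →-dec y ≟ b

-- An interior vertex of a path has two distinct neighbours on it.
pendant-endpoint : Pendant G a b → Path G x y p → a ∈ˡ p → a ≡ x ⊎ a ≡ y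
pendant-endpoint P (stop _ , _) (here refl) = inj₁ refl
pendant-endpoint P (step _ _ , _) (here refl) = inj₁ refl
pendant-endpoint {G = G} P@(_ , only) (step e w , x∉ ∷ u) (there a∈)
  with pendant-endpoint P (w , u) a∈
... | inj₂ a≡y = inj₂ a≡y
... | inj₁ refl with w
...   | stop _ = inj₂ refl
...   | step e′ w′ = ⊥-elim (All.lookup x∉ (there (start∈walk w′))
                       (trans (only _ (symm G e)) (sym (only _ e′))))

-- The edge at `a` is monitored by a pair with a shortest path through `a`, and a pendant vertex on
-- a path is one of its ends.
pendant∈MEG : Pendant G a b → GlobalMEGSet G M → a ∈ M
pendant∈MEG P@(e , _) g with monitored g e
... | x , y , x∈ , y∈ , R , mon with shortestPath R
... | p , S@(path , _) with pendant-endpoint P path (liesOn⇒∈ (mon p S))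
... | inj₁ refl = x∈
... | inj₂ refl = y∈

-- Every path from `a` to another vertex begins with the only edge at `a`.
pendant-monitored : Pendant G a b → a ∈ M → c ∈ M → a ≢ c → Reachable G a c → Monitored G M a b
pendant-monitored {G = G} {a} {b} {c = c} (_ , only) a∈ c∈ a≢c R = a , c , a∈ , c∈ , R , mon
  where
  mon : Monitors G a c a b
  mon _ ((stop _ , _) , _) = ⊥-elim (a≢c refl)
  mon _ ((step e (stop _) , _) , _) with only _ e
  ... | refl = inj₁ (here (refl ∷ refl ∷ []))
  mon _ ((step e (step _ _) , _) , _) with only _ e
  ... | refl = inj₁ (here (refl ∷ refl ∷ []))

monitored-swap : Monitored G M a b → Monitored G M b a
monitored-swap (x , y , x∈ , y∈ , R , mon) = x , y , x∈ , y∈ , R , monitors-swap mon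

∣pendants∣≤meg : (G : Graph n) (L : Subset n) → (∀ x → x ∈ L → ∃ (Pendant G x)) → ∣ L ∣ ≤ meg G
∣pendants∣≤meg G L pendant = ∣L∣≤meg G L λ g {x} x∈ → pendant∈MEG (proj₂ (pendant x x∈)) g

pendants? : (G : Graph n) (L : Subset n) → Dec (∀ x → x ∈ L → ∃ (Pendant G x))
pendants? G L = all? λ x → x ∈? L →-dec any? (pendant? G x)

-- Deleting an edge

-- Meant for a graph `H` from which the edge `st` was deleted: the edge is the junction of the two
-- halves, and the order of `s` and `t` records the direction in which it is crossed.
Crossing : Graph n → (s t x y : Fin n) → List (Fin n) → Set
Crossing H s t x y r = ∃₂ λ p q → r ≡ p ++ q × Walk H x s p × Walk H t y q

module Deletion (G : Graph n) (u v : Fin n) where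

  private
    G′ = deleteEdge G u v

  walk-undelete : Walk G′ x y p → Walk G x y p
  walk-undelete = walk-map {G = G′} {H = G} id proj₁

  reachable-undelete : Reachable G′ x y → Reachable G x y
  reachable-undelete (p , w , uniq) = p , walk-undelete w , uniq

  -- `s` is an end of the deleted edge, so a walk that misses `s` cannot use that edge.
  walk-avoiding : s ≡ u ⊎ s ≡ v → All (s ≢_) p → Walk G x y p → Walk G′ x y p
  walk-avoiding s∈e _ (stop i) = stop i
  walk-avoiding {s = s} s∈e (s≢x ∷ s≢) (step {x} {y} a w) = step (a , not-e s∈e) (walk-avoiding s∈e s≢ w)
    where
    s≢y = All.lookup s≢ (start∈walk w)
    not-e : s ≡ u ⊎ s ≡ v → ¬ SameEdge u v x y
    not-e (inj₁ refl) (inj₁ (refl , _)) = s≢x refl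
    not-e (inj₁ refl) (inj₂ (_ , refl)) = s≢y refl
    not-e (inj₂ refl) (inj₁ (_ , refl)) = s≢y refl
    not-e (inj₂ refl) (inj₂ (refl , _)) = s≢x refl

  crossing-step : Adj G′ x z → Crossing G′ s t z y p → Crossing G′ s t x y (x ∷ p)
  crossing-step a (p , q , refl , w , w′) = _ ∷ p , q , refl , step a w , w′

  -- A path never revisits a vertex, so after its first use of the edge the remainder avoids one end
  -- of it and stays in `G′`.
  path-crosses : Path G x y p → Walk G′ x y p ⊎ Crossing G′ u v x y p ⊎ Crossing G′ v u x y p
  path-crosses (stop i , _) = inj₁ (stop i)
  path-crosses (step {x} {y} a w , x∉ ∷ uniq)
    with (x ≟ u ×-dec y ≟ v) ⊎-dec (x ≟ v ×-dec y ≟ u)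
  ... | yes (inj₁ (refl , refl)) =
    inj₂ (inj₁ (_ ∷ [] , _ , refl , stop (adj⇒V G a) , walk-avoiding (inj₁ refl) x∉ w))
  ... | yes (inj₂ (refl , refl)) =
    inj₂ (inj₂ (_ ∷ [] , _ , refl , stop (adj⇒V G a) , walk-avoiding (inj₂ refl) x∉ w))
  ... | no ≢e = Sum.map (step (a , ≢e)) (Sum.map (crossing-step (a , ≢e)) (crossing-step (a , ≢e)))
    (path-crosses (w , uniq))

-- Consecutive entries lie in one half or straddle the junction, where the walks identify them as
-- `s` and `t`.
infix-++ : Walk G x s p → Walk G t y q → Infix _≡_ (a ∷ b ∷ []) (p ++ q) →
           Infix _≡_ (a ∷ b ∷ []) p ⊎ Infix _≡_ (a ∷ b ∷ []) q ⊎ (a ≡ s × b ≡ t)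
infix-++ (stop _) (stop _) (here (refl ∷ refl ∷ [])) = inj₂ (inj₂ (refl , refl))
infix-++ (stop _) (step _ _) (here (refl ∷ refl ∷ [])) = inj₂ (inj₂ (refl , refl))
infix-++ (stop _) w′ (there i) = inj₂ (inj₁ i)
infix-++ (step _ (stop _)) w′ (here (refl ∷ refl ∷ [])) = inj₁ (here (refl ∷ refl ∷ []))
infix-++ (step _ (step _ _)) w′ (here (refl ∷ refl ∷ [])) = inj₁ (here (refl ∷ refl ∷ []))
infix-++ (step _ w) w′ (there i) = Sum.map₁ there (infix-++ w w′ i)

liesOn-++ : ¬ Reachable G s t → Walk G x s p → Walk G t y q → Adj G a b →
            LiesOn a b (p ++ q) → LiesOn a b p ⊎ LiesOn a b q
liesOn-++ {G = G} sep w w′ e (inj₁ i) with infix-++ w w′ i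
... | inj₁ j = inj₁ (inj₁ j)
... | inj₂ (inj₁ j) = inj₂ (inj₁ j)
... | inj₂ (inj₂ (refl , refl)) = ⊥-elim (sep (adj⇒reachable G e))
liesOn-++ {G = G} sep w w′ e (inj₂ i) with infix-++ w w′ i
... | inj₁ j = inj₁ (inj₂ j)
... | inj₂ (inj₁ j) = inj₂ (inj₂ j)
... | inj₂ (inj₂ (refl , refl)) = ⊥-elim (sep (adj⇒reachable G (symm G e)))

infix-junction : Walk G x s p → Walk G t y q → Infix _≡_ (s ∷ t ∷ []) (p ++ q)
infix-junction (stop _) (stop _) = here (refl ∷ refl ∷ [])
infix-junction (stop _) (step _ _) = here (refl ∷ refl ∷ [])
infix-junction (step _ w) w′ = there (infix-junction w w′)

walk-++ : Walk G x s p → Adj G s t → Walk G t y q → Walk G x y (p ++ q)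
walk-++ (stop _) e w′ = step e w′
walk-++ (step a w) e w′ = step a (walk-++ w e w′)

-- Deleting a cut edge

module Bridge {n : ℕ} (G : Graph n) {u v : Fin n} (uv : Adj G u v)
              (sep : ¬ Reachable (deleteEdge G u v) u v) where

  open Deletion G u v

  private
    G′ = deleteEdge G u v

  -- A connection of `x` and `y` in `G′` would, together with the two halves, connect the ends of
  -- the bridge.
  crossing⇒separated : SameEdge u v s t → Crossing G′ s t x y p → ¬ Reachable G′ x y
  crossing⇒separated (inj₁ (refl , refl)) (_ , _ , _ , w , w′) R = sep
    (reachable-trans (reachable-sym (walk⇒reachable w))
      (reachable-trans R (reachable-sym (walk⇒reachable w′))))
  crossing⇒separated (inj₂ (refl , refl)) (_ , _ , _ , w , w′) R = sep
    (reachable-trans (walk⇒reachable w′)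
      (reachable-trans (reachable-sym R) (walk⇒reachable w)))

  -- Crossing the bridge changes the component of `G′`, so a path within one component stays off it.
  -- With `path-undelete`, such a pair has the same shortest paths in both graphs.
  path-delete : Reachable G′ x y → Path G x y p → Path G′ x y p
  path-delete R P with path-crosses P
  ... | inj₁ w = w , proj₂ P
  ... | inj₂ (inj₁ c) = ⊥-elim (crossing⇒separated (inj₁ (refl , refl)) c R)
  ... | inj₂ (inj₂ c) = ⊥-elim (crossing⇒separated (inj₂ (refl , refl)) c R)

  path-undelete : Path G′ x y p → Path G x y p
  path-undelete (w , uniq) = walk-undelete w , uniq

  monitors-undelete : Reachable G′ x y → Monitors G′ x y a b → Monitors G x y a b
  monitors-undelete R mon p (P , least) = mon p (path-delete R P , λ q Q → least q (path-undelete Q))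

  monitors-delete : Reachable G′ x y → Monitors G x y a b → Monitors G′ x y a b
  monitors-delete R mon p (P , least) = mon p (path-undelete P , λ q Q → least q (path-delete R Q))

  -- A path between the two sides cannot stay in `G′`, and in either direction of crossing its
  -- junction is the edge `uv`.
  bridge-monitored : x ∈ M → y ∈ M → Reachable G′ u x → Reachable G′ v y → Monitored G M u v
  bridge-monitored {x} {y = y} x∈ y∈ ux vy = x , y , x∈ , y∈ , xy , mon
    where
    xy : Reachable G x y
    xy = reachable-trans (reachable-undelete (reachable-sym ux))
           (reachable-trans (adj⇒reachable G uv) (reachable-undelete vy))
    mon : Monitors G x y u v
    mon p (P , _) with path-crosses P
    ... | inj₁ w = ⊥-elim (sep (reachable-trans ux
                     (reachable-trans (walk⇒reachable w) (reachable-sym vy))))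
    ... | inj₂ (inj₁ (_ , _ , refl , w , w′)) = inj₁ (infix-junction w w′)
    ... | inj₂ (inj₂ (_ , _ , refl , w , w′)) = inj₂ (infix-junction w w′)

  neighbour-u : 2 ≤ deg G u → ∃ (Adj G′ u)
  neighbour-u 2≤u with 2≤deg⇒other-neighbour G 2≤u v
  ... | a , ua , a≢v = a , ua , λ where
    (inj₁ (_ , a≡v)) → a≢v a≡v
    (inj₂ (u≡v , _)) → adj⇒≢ G uv u≡v

  neighbour-v : 2 ≤ deg G v → ∃ (Adj G′ v)
  neighbour-v 2≤v with 2≤deg⇒other-neighbour G 2≤v u
  ... | b , vb , b≢u = b , vb , λ where
    (inj₁ (v≡u , _)) → adj⇒≢ G uv (sym v≡u)
    (inj₂ (_ , b≡u)) → b≢u b≡u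

  GlobalMEGSet-undelete : 2 ≤ deg G u → 2 ≤ deg G v → GlobalMEGSet G′ M → GlobalMEGSet G M
  GlobalMEGSet-undelete {M} 2≤u 2≤v g = record
    { ⊆V = ⊆V g
    ; monitored = mon
    ; nonisolated = λ x∈ → let y , e , _ = nonisolated g x∈ in y , e
    }
    where
    -- An edge of `G′` is monitored from within its own component, so `M` meets that component. This
    -- is applied to the component of each end of the bridge.
    visible : Adj G′ a b → ∃ λ x → x ∈ M × Reachable G′ a x
    visible e with monitored g e
    ... | x , _ , x∈ , _ , R , m = x , x∈ , reachable-sym (monitors⇒reachable R m)

    monUV : Monitored G M u v
    monUV with visible (proj₂ (neighbour-u 2≤u)) | visible (proj₂ (neighbour-v 2≤v))
    ... | x , x∈ , ux | y , y∈ , vy = bridge-monitored x∈ y∈ ux vy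

    mon : Adj G a b → Monitored G M a b
    mon {a} {b} e with (a ≟ u ×-dec b ≟ v) ⊎-dec (a ≟ v ×-dec b ≟ u)
    ... | yes (inj₁ (refl , refl)) = monUV
    ... | yes (inj₂ (refl , refl)) = monitored-swap monUV
    ... | no ≢e with monitored g (e , ≢e)
    ...   | x , y , x∈ , y∈ , R , m = x , y , x∈ , y∈ , reachable-undelete R , monitors-undelete R m

  bridge-adj : SameEdge u v s t → Adj G s t
  bridge-adj (inj₁ (refl , refl)) = uv
  bridge-adj (inj₂ (refl , refl)) = symm G uv

  bridge-separates : SameEdge u v s t → ¬ Reachable G′ s t
  bridge-separates (inj₁ (refl , refl)) = sep
  bridge-separates (inj₂ (refl , refl)) = sep ∘ reachable-sym

  path-crosses-at : SameEdge u v s t → Path G x y p →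
                    Walk G′ x y p ⊎ Crossing G′ s t x y p ⊎ Crossing G′ t s x y p
  path-crosses-at (inj₁ (refl , refl)) P = path-crosses P
  path-crosses-at (inj₂ (refl , refl)) P = Sum.map₂ swap (path-crosses P)

  -- The halves lie in different components of `G′`, hence are disjoint. Any competitor must cross
  -- from `s` to `t`, and each of its halves is a walk no shorter than the matching shortest path.
  shortest-++ : SameEdge u v s t → ShortestPath G′ x s p → ShortestPath G′ t y q →
                ShortestPath G x y (p ++ q)
  shortest-++ {s} {t} {x} {p} {y} {q} st Sp@((wp , up) , _) Sq@((wq , uq) , _) =
    (walk-++ (walk-undelete wp) (bridge-adj st) (walk-undelete wq) , Unique.++⁺ up uq disjoint) , least
    where
    xs = walk⇒reachable wp
    ty = walk⇒reachable wq

    disjoint : ∀ {z} → ¬ (z ∈ˡ p × z ∈ˡ q)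
    disjoint (z∈p , z∈q) = bridge-separates st
      (reachable-trans (reachable-sym xs) (reachable-trans (walk-visits wp z∈p)
        (reachable-sym (walk-visits wq z∈q))))

    least : ∀ r → Path G x y r → length (p ++ q) ≤ length r
    least r P with path-crosses-at st P
    ... | inj₁ w = ⊥-elim (bridge-separates st (reachable-trans (reachable-sym xs)
                     (reachable-trans (walk⇒reachable w) (reachable-sym ty))))
    ... | inj₂ (inj₂ (_ , _ , _ , w , _)) = ⊥-elim (bridge-separates st
                     (reachable-trans (reachable-sym xs) (walk⇒reachable w)))
    ... | inj₂ (inj₁ (p′ , q′ , refl , w , w′)) = subst₂ _≤_ (sym (length-++ p)) (sym (length-++ p′))
                     (ℕ.+-mono-≤ (shortest≤walk Sp w) (shortest≤walk Sq w′))

  -- The two halves of a shortest path across the bridge are shortest paths of G′,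
  -- and an edge of G′ can only lie on the half in its own component.
  monitors-split : SameEdge u v s t → Reachable G′ x s → Reachable G′ t y → Adj G′ a b →
                   Monitors G x y a b → Monitors G′ x s a b ⊎ Monitors G′ t y a b
  monitors-split {s} {t} {x} {y} {a} {b} st xs ty e mon
    with reachable? G′ x a | shortestPath xs | shortestPath ty
  ... | yes xa | _ | q , Sq@((wq , _) , _) = inj₁ λ p Sp@((wp , _) , _) →
    case liesOn-++ (bridge-separates st) wp wq e (mon (p ++ q) (shortest-++ st Sp Sq)) of λ where
      (inj₁ onp) → onp
      (inj₂ onq) → ⊥-elim (bridge-separates st (reachable-trans (reachable-sym xs)
        (reachable-trans xa (reachable-sym (walk-visits wq (liesOn⇒∈ onq))))))
  ... | no ¬xa | p , Sp@((wp , _) , _) | _ = inj₂ λ q Sq@((wq , _) , _) →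
    case liesOn-++ (bridge-separates st) wp wq e (mon (p ++ q) (shortest-++ st Sp Sq)) of λ where
      (inj₁ onp) → ⊥-elim (¬xa (walk-visits wp (liesOn⇒∈ onp)))
      (inj₂ onq) → onq

  GlobalMEGSet-delete : 2 ≤ deg G u → 2 ≤ deg G v → GlobalMEGSet G M →
                        GlobalMEGSet G′ (M ∪ (⁅ u ⁆ ∪ ⁅ v ⁆))
  GlobalMEGSet-delete {M} 2≤u 2≤v g = record { ⊆V = sub ; monitored = mon ; nonisolated = noniso }
    where
    M⁺ = M ∪ (⁅ u ⁆ ∪ ⁅ v ⁆)

    M⊆ : x ∈ M → x ∈ M⁺
    M⊆ x∈ = x∈p∪q⁺ (inj₁ x∈)

    u∈ : u ∈ M⁺
    u∈ = x∈p∪q⁺ (inj₂ (x∈p∪q⁺ (inj₁ (x∈⁅x⁆ u))))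

    v∈ : v ∈ M⁺
    v∈ = x∈p∪q⁺ (inj₂ (x∈p∪q⁺ (inj₂ (x∈⁅x⁆ v))))

    ∈M⁺⁻ : x ∈ M⁺ → x ∈ M ⊎ x ≡ u ⊎ x ≡ v
    ∈M⁺⁻ x∈ = Sum.map₂ (Sum.map (x∈⁅y⁆⇒x≡y u) (x∈⁅y⁆⇒x≡y v) ∘ x∈p∪q⁻ _ _) (x∈p∪q⁻ M _ x∈)

    sub : M⁺ ⊆ V G
    sub x∈ with ∈M⁺⁻ x∈
    ... | inj₁ x∈M = ⊆V g x∈M
    ... | inj₂ (inj₁ refl) = adj⇒V G uv
    ... | inj₂ (inj₂ refl) = adj⇒Vʳ G uv

    noniso : x ∈ M⁺ → ∃ (Adj G′ x)
    -- The ends of the bridge come first, even if they lie in `M`: the neighbour known in `G` might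
    -- be across the bridge, so the degree hypotheses supply another.
    noniso {x} x∈ with x ≟ u | x ≟ v | ∈M⁺⁻ x∈
    ... | yes refl | _ | _ = neighbour-u 2≤u
    ... | no _ | yes refl | _ = neighbour-v 2≤v
    ... | no x≢u | no x≢v | inj₂ x∈e = ⊥-elim (Sum.[ x≢u , x≢v ] x∈e)
    ... | no x≢u | no x≢v | inj₁ x∈M with nonisolated g x∈M
    ...   | y , e = y , e , Sum.[ x≢u ∘ proj₁ , x≢v ∘ proj₁ ]

    mon-across : SameEdge u v s t → s ∈ M⁺ → t ∈ M⁺ → x ∈ M → y ∈ M → Adj G′ a b →
                 Monitors G x y a b → Crossing G′ s t x y p → Monitored G′ M⁺ a b
    mon-across st s∈ t∈ x∈ y∈ e m (_ , _ , _ , w , w′)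
      with monitors-split st (walk⇒reachable w) (walk⇒reachable w′) e m
    ... | inj₁ m′ = _ , _ , M⊆ x∈ , s∈ , walk⇒reachable w , m′
    ... | inj₂ m′ = _ , _ , t∈ , M⊆ y∈ , walk⇒reachable w′ , m′

    mon : Adj G′ a b → Monitored G′ M⁺ a b
    mon e with monitored g (proj₁ e)
    ... | x , y , x∈ , y∈ , (_ , P) , m with path-crosses P
    ...   | inj₁ w = x , y , M⊆ x∈ , M⊆ y∈ , walk⇒reachable w , monitors-delete (walk⇒reachable w) m
    ...   | inj₂ (inj₁ c) = mon-across (inj₁ (refl , refl)) u∈ v∈ x∈ y∈ e m c
    ...   | inj₂ (inj₂ c) = mon-across (inj₂ (refl , refl)) v∈ u∈ x∈ y∈ e m c

  meg≤meg-delete : 2 ≤ deg G u → 2 ≤ deg G v → meg G ≤ meg (deleteEdge G u v)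
  meg≤meg-delete 2≤u 2≤v = meg-elim (meg G ≤_) (deleteEdge G u v) (meg≤n G)
    (λ g → meg≤∣M∣ G (GlobalMEGSet-undelete 2≤u 2≤v g))

  ∣M∪uv∣≤∣M∣+2 : (M : Subset n) → ∣ M ∪ (⁅ u ⁆ ∪ ⁅ v ⁆) ∣ ≤ ∣ M ∣ + 2
  ∣M∪uv∣≤∣M∣+2 M = begin
    ∣ M ∪ (⁅ u ⁆ ∪ ⁅ v ⁆) ∣         ≤⟨ ∣p∪q∣≤∣p∣+∣q∣ M _ ⟩
    ∣ M ∣ + ∣ ⁅ u ⁆ ∪ ⁅ v ⁆ ∣       ≤⟨ ℕ.+-monoʳ-≤ ∣ M ∣ (∣p∪q∣≤∣p∣+∣q∣ ⁅ u ⁆ ⁅ v ⁆) ⟩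
    ∣ M ∣ + (∣ ⁅ u ⁆ ∣ + ∣ ⁅ v ⁆ ∣) ≡⟨ cong (∣ M ∣ +_) (cong₂ _+_ (∣⁅x⁆∣≡1 u) (∣⁅x⁆∣≡1 v)) ⟩
    ∣ M ∣ + 2                       ∎
    where open ℕ.≤-Reasoning

  meg-delete≤meg+2 : 2 ≤ deg G u → 2 ≤ deg G v → meg (deleteEdge G u v) ≤ meg G + 2
  meg-delete≤meg+2 2≤u 2≤v = meg-elim (λ k → meg (deleteEdge G u v) ≤ k + 2) G
    -- The default case: `k` is `n`, which bounds `meg` of every graph over `Fin n`.
    (ℕ.≤-trans (meg≤n (deleteEdge G u v)) (ℕ.m≤m+n n 2))
    (λ {M} g → ℕ.≤-trans (meg≤∣M∣ (deleteEdge G u v) (GlobalMEGSet-delete 2≤u 2≤v g)) (∣M∪uv∣≤∣M∣+2 M))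

-- Cut edges and separation

-- If the ends stayed connected, every use of the edge could be rerouted, so `G′` would have at most
-- one component, whereas `G` already has at least one.
cutEdge⇒separated : (G : Graph n) {u v : Fin n} → Connected G → CutEdge G u v →
                    ¬ Reachable (deleteEdge G u v) u v
cutEdge⇒separated G {u} {v} ((x , x∈) , conn) (_ , more) R =
  ℕ.<-irrefl refl (ℕ.≤-trans (s≤s (1≤length (∈-components⁺ G x∈)))
    (ℕ.≤-trans more (components≤1 G′ λ y z y∈ z∈ → reconnect (proj₁ (proj₂ (conn y z y∈ z∈))))))
  where
  G′ = deleteEdge G u v
  reconnect : Walk G y z p → Reachable G′ y z
  reconnect (stop i) = reachable-refl G′ i
  reconnect (step {y} {z} a w) with (y ≟ u ×-dec z ≟ v) ⊎-dec (y ≟ v ×-dec z ≟ u)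
  ... | yes (inj₁ (refl , refl)) = reachable-trans R (reconnect w)
  ... | yes (inj₂ (refl , refl)) = reachable-trans (reachable-sym R) (reconnect w)
  ... | no ≢e = reachable-trans (adj⇒reachable G′ (a , ≢e)) (reconnect w)

separated⇒cutEdge : (G : Graph n) {u v : Fin n} → Connected G → Adj G u v →
                    ¬ Reachable (deleteEdge G u v) u v → CutEdge G u v
separated⇒cutEdge G {u} {v} (_ , conn) uv sep = uv , ℕ.≤-trans (s≤s (components≤1 G conn))
  (2≤components (deleteEdge G u v) (adj⇒V G uv) (adj⇒Vʳ G uv) sep)

-- Examples

-- Existentially closed, so that checking an example never compares, and hence never
-- evaluates, meg of a concrete graph.
MegPreserved MegIncreasesByTwo : Set₁
MegPreserved = Σ[ n ∈ ℕ ] Σ[ G ∈ Graph n ] Σ[ u ∈ Fin n ] Σ[ v ∈ Fin n ]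
  Connected G × CutEdge G u v × 2 ≤ deg G u × 2 ≤ deg G v
  × meg (deleteEdge G u v) ≡ meg G
MegIncreasesByTwo = Σ[ n ∈ ℕ ] Σ[ G ∈ Graph n ] Σ[ u ∈ Fin n ] Σ[ v ∈ Fin n ]
  Connected G × CutEdge G u v × 2 ≤ deg G u × 2 ≤ deg G v
  × meg (deleteEdge G u v) ≡ meg G + 2

module _ (G : Graph n) {u v : Fin n} (conn : Connected G) (uv : Adj G u v)
         (sep : ¬ Reachable (deleteEdge G u v) u v) (2≤u : 2 ≤ deg G u) (2≤v : 2 ≤ deg G v) where

  open Bridge G uv sep

  -- `L` serves twice: as a MEG-set after the deletion it bounds the larger number from above, and
  -- as a set of pendant vertices of `G` it bounds the smaller one from below.
  megPreserved : (L : Subset n) → GlobalMEGSet (deleteEdge G u v) L →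
                 (∀ x → x ∈ L → ∃ (Pendant G x)) → MegPreserved
  megPreserved L g pendant =
    _ , G , u , v , conn , separated⇒cutEdge G conn uv sep , 2≤u , 2≤v , ℕ.≤-antisym
      (ℕ.≤-trans (meg≤∣M∣ (deleteEdge G u v) g) (∣pendants∣≤meg G L pendant))
      (meg≤meg-delete 2≤u 2≤v)

  -- `M` bounds `meg G` from above, and the vertices of `L`, pendant after the deletion, bound the
  -- other number from below.
  megIncreasesByTwo : (M L : Subset n) → GlobalMEGSet G M →
                      (∀ x → x ∈ L → ∃ (Pendant (deleteEdge G u v) x)) → ∣ M ∣ + 2 ≤ ∣ L ∣ →
                      MegIncreasesByTwo
  megIncreasesByTwo M L g pendant ∣M∣+2≤∣L∣ =
    _ , G , u , v , conn , separated⇒cutEdge G conn uv sep , 2≤u , 2≤v , ℕ.≤-antisym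
      (meg-delete≤meg+2 2≤u 2≤v)
      (ℕ.≤-trans (ℕ.+-monoˡ-≤ 2 (meg≤∣M∣ G g))
        (ℕ.≤-trans ∣M∣+2≤∣L∣ (∣pendants∣≤meg (deleteEdge G u v) L pendant)))

-- Forests given by a parent map

-- A root is its own parent; the clause `x ≢ y` removes the resulting loop.
forest : (Fin n → Fin n) → Graph n
forest parent = record
  { V = ⊤
  ; Adj = λ x y → x ≢ y × (parent x ≡ y ⊎ parent y ≡ x)
  ; adj? = λ x y → ¬? (x ≟ y) ×-dec (parent x ≟ y ⊎-dec parent y ≟ x)
  ; symm = λ (x≢y , e) → x≢y ∘ sym , swap e
  ; irref = λ (x≢x , _) → x≢x refl
  ; adj⇒V = λ _ → ∈⊤
  }

-- Two parent steps lead from every vertex to the root.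
forest-connected : (parent : Fin n → Fin n) (root : Fin n) → (∀ x → parent (parent x) ≡ root) →
                   Connected (forest parent)
forest-connected {n} parent root rooted = (root , ∈⊤) , λ x y _ _ →
  reachable-trans (to-root x) (reachable-sym (to-root y))
  where
  T = forest parent
  to-parent : ∀ x → Reachable T x (parent x)
  to-parent x with x ≟ parent x
  ... | yes eq = subst (Reachable T x) eq (reachable-refl T ∈⊤)
  ... | no x≢ = adj⇒reachable T (x≢ , inj₁ refl)
  to-root : ∀ x → Reachable T x root
  to-root x = subst (Reachable T x) (rooted x) (reachable-trans (to-parent x) (to-parent (parent x)))

-- A closed set containing one vertex but not the other certifies their separation, and closedness
-- is decidable edge by edge.
reachable-closed : (S : Subset n) → (∀ x y → Adj G x y → x ∈ S → y ∈ S) →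
                   Reachable G x y → x ∈ S → y ∈ S
reachable-closed {G = G} S closed (_ , w , _) = go w
  where
  go : Walk G x y p → x ∈ S → y ∈ S
  go (stop _) x∈ = x∈
  go (step a w) x∈ = go w (closed _ _ a x∈)

closed? : (G : Graph n) (S : Subset n) → Dec (∀ x y → Adj G x y → x ∈ S → y ∈ S)
closed? G S = all? λ x → all? λ y → adj? G x y →-dec (x ∈? S →-dec y ∈? S)

-- Tightness of the upper bound

module PathOnFourVertices where

  parent : Fin 4 → Fin 4
  parent = Vec.lookup (# 1 ∷ # 1 ∷ # 1 ∷ # 2 ∷ [])

  P₄ P₄′ : Graph 4
  P₄ = forest parent
  P₄′ = deleteEdge P₄ (# 1) (# 2)

  ends : Subset 4
  ends = inside ∷ outside ∷ outside ∷ inside ∷ []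

  connected : Connected P₄
  connected = forest-connected parent (# 1) (from-yes (all? λ x → parent (parent x) ≟ # 1))

  separated : ¬ Reachable P₄′ (# 1) (# 2)
  separated R = from-yes (¬? (# 2 ∈? S)) (reachable-closed S (from-yes (closed? P₄′ S)) R (from-yes (# 1 ∈? S)))
    where
    S : Subset 4
    S = inside ∷ inside ∷ outside ∷ outside ∷ []

  middle : Adj P₄ (# 1) (# 2)
  middle = from-yes (adj? P₄ (# 1) (# 2))

  ends-MEG : GlobalMEGSet P₄ ends
  ends-MEG = record
    { ⊆V = λ _ → ∈⊤
    ; monitored = λ {a} {b} e → mon (edges a b e)
    ; nonisolated = λ {x} x∈ → let y , e , _ = from-yes (pendants? P₄ ends) x x∈ in y , e
    }
    where
    Covered : (a b : Fin 4) → Set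
    Covered a b = Pendant P₄ a b × a ∈ ends × ∃ λ c → c ∈ ends × a ≢ c

    covered? : (a b : Fin 4) → Dec (Covered a b)
    covered? a b = pendant? P₄ a b ×-dec a ∈? ends ×-dec any? λ c → c ∈? ends ×-dec ¬? (a ≟ c)

    edges : ∀ a b → Adj P₄ a b → SameEdge (# 1) (# 2) a b ⊎ Covered a b ⊎ Covered b a
    edges = from-yes (all? λ a → all? λ b → adj? P₄ a b →-dec
      (((a ≟ # 1 ×-dec b ≟ # 2) ⊎-dec (a ≟ # 2 ×-dec b ≟ # 1)) ⊎-dec covered? a b ⊎-dec covered? b a))

    mon-pendant : Covered a b → Monitored P₄ ends a b
    mon-pendant (P , a∈ , c , c∈ , a≢c) = pendant-monitored P a∈ c∈ a≢c (proj₂ connected _ _ ∈⊤ ∈⊤)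

    mon-middle : Monitored P₄ ends (# 1) (# 2)
    mon-middle = Bridge.bridge-monitored P₄ middle separated
      (from-yes (# 0 ∈? ends)) (from-yes (# 3 ∈? ends))
      (adj⇒reachable P₄′ (from-yes (adj? P₄′ (# 1) (# 0))))
      (adj⇒reachable P₄′ (from-yes (adj? P₄′ (# 2) (# 3))))

    mon : SameEdge (# 1) (# 2) a b ⊎ Covered a b ⊎ Covered b a → Monitored P₄ ends a b
    mon (inj₁ (inj₁ (refl , refl))) = mon-middle
    mon (inj₁ (inj₂ (refl , refl))) = monitored-swap mon-middle
    mon (inj₂ (inj₁ c)) = mon-pendant c
    mon (inj₂ (inj₂ c)) = monitored-swap (mon-pendant c)

  2≤deg₁ : 2 ≤ deg P₄ (# 1)
  2≤deg₁ = from-yes (2 ≤? deg P₄ (# 1))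

  2≤deg₂ : 2 ≤ deg P₄ (# 2)
  2≤deg₂ = from-yes (2 ≤? deg P₄ (# 2))

  gapTwo : MegIncreasesByTwo
  -- Without its middle edge the path is two disjoint edges, so all four vertices are pendant,
  -- whereas the two ends suffice before.
  gapTwo = megIncreasesByTwo P₄ connected middle separated 2≤deg₁ 2≤deg₂ ends ⊤ ends-MEG
    (from-yes (pendants? P₄′ ⊤)) ℕ.≤-refl

-- Tightness of the lower bound

module JoinedPathsOnThreeVertices where

  parent : Fin 6 → Fin 6
  parent = Vec.lookup (# 0 ∷ # 0 ∷ # 0 ∷ # 0 ∷ # 3 ∷ # 3 ∷ [])

  T T′ : Graph 6
  T = forest parent
  T′ = deleteEdge T (# 0) (# 3)

  leaves : Subset 6
  leaves = outside ∷ inside ∷ inside ∷ outside ∷ inside ∷ inside ∷ []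

  connected : Connected T
  connected = forest-connected parent (# 0) (from-yes (all? λ x → parent (parent x) ≟ # 0))

  separated : ¬ Reachable T′ (# 0) (# 3)
  separated R = from-yes (¬? (# 3 ∈? S)) (reachable-closed S (from-yes (closed? T′ S)) R (from-yes (# 0 ∈? S)))
    where
    S : Subset 6
    S = inside ∷ inside ∷ inside ∷ outside ∷ outside ∷ outside ∷ []

  middle : Adj T (# 0) (# 3)
  middle = from-yes (adj? T (# 0) (# 3))

  leaves-MEG : GlobalMEGSet T′ leaves
  leaves-MEG = record
    { ⊆V = λ _ → ∈⊤
    ; monitored = λ {a} {b} e → Sum.[ mon , monitored-swap ∘ mon ] (edges a b e)
    ; nonisolated = λ {x} x∈ → let y , e , _ = from-yes (pendants? T′ leaves) x x∈ in y , e
    }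
    where
    -- `T′` is disconnected, so the partner `c` is required to be adjacent to `b`, which puts it in
    -- the component of `a`: it is the other leaf at the same centre.
    Covered : (a b : Fin 6) → Set
    Covered a b = Pendant T′ a b × a ∈ leaves × ∃ λ c → c ∈ leaves × a ≢ c × Adj T′ b c

    covered? : (a b : Fin 6) → Dec (Covered a b)
    covered? a b = pendant? T′ a b ×-dec a ∈? leaves ×-dec
      any? λ c → c ∈? leaves ×-dec ¬? (a ≟ c) ×-dec adj? T′ b c

    edges : ∀ a b → Adj T′ a b → Covered a b ⊎ Covered b a
    edges = from-yes (all? λ a → all? λ b → adj? T′ a b →-dec (covered? a b ⊎-dec covered? b a))

    mon : Covered a b → Monitored T′ leaves a b
    mon (P , a∈ , c , c∈ , a≢c , bc) = pendant-monitored P a∈ c∈ a≢c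
      (reachable-trans (adj⇒reachable T′ (proj₁ P)) (adj⇒reachable T′ bc))

  2≤deg₀ : 2 ≤ deg T (# 0)
  2≤deg₀ = from-yes (2 ≤? deg T (# 0))

  2≤deg₃ : 2 ≤ deg T (# 3)
  2≤deg₃ = from-yes (2 ≤? deg T (# 3))

  preserved : MegPreserved
  preserved = megPreserved T connected middle separated 2≤deg₀ 2≤deg₃ leaves leaves-MEG
    (from-yes (pendants? T leaves))

theorem4p7 : (∀ (n : ℕ) (G : Graph n) (u v : Fin n) →
    Connected G → CutEdge G u v → 2 ≤ deg G u → 2 ≤ deg G v →
    meg G ≤ meg (deleteEdge G u v) × meg (deleteEdge G u v) ≤ meg G + 2)
    × (Σ[ n ∈ ℕ ] Σ[ G ∈ Graph n ] Σ[ u ∈ Fin n ] Σ[ v ∈ Fin n ]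
    Connected G × CutEdge G u v × 2 ≤ deg G u × 2 ≤ deg G v
    × meg (deleteEdge G u v) ≡ meg G)
    × (Σ[ n ∈ ℕ ] Σ[ G ∈ Graph n ] Σ[ u ∈ Fin n ] Σ[ v ∈ Fin n ]
    Connected G × CutEdge G u v × 2 ≤ deg G u × 2 ≤ deg G v
    × meg (deleteEdge G u v) ≡ meg G + 2)
theorem4p7 =
  (λ n G u v conn cut 2≤u 2≤v →
    let open Bridge G (proj₁ cut) (cutEdge⇒separated G conn cut)
    in meg≤meg-delete 2≤u 2≤v , meg-delete≤meg+2 2≤u 2≤v) ,
  JoinedPathsOnThreeVertices.preserved ,
  PathOnFourVertices.gapTwo
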